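{- We have $$\lim_{n\to\infty}\frac{\varphi_n}{h_n}=\frac45,\qquad \lim_{n\to\infty}\frac{\theta_n}{p_n}=\frac45,\qquad \lim_{n\to\infty}\frac{q_n}{h_n}=\frac15,\qquad \lim_{n\to\infty}\frac{r_n}{p_n}=\frac15.$$
   Context: Let $s=\sqrt3/2$. Consider the standard triangular lattice in the plane whose vertices are the points $(a+b/2,\,bs)$ with $a,b\in\mathbb Z$ and whose edges are the unit segments joining lattice points in the directions $0^\circ,60^\circ,120^\circ$; it divides the plane into unit equilateral triangles called cells. A small tile is a single cell; a large tile is an equilateral triangle of side $2$ whose vertices are lattice points (so it is a union of $4$ cells; it may point up or down). For a region $R$ that is a finite union of cells, a tiling of $R$ is a finite set of small and large tiles, each contained in $R$, with pairwise disjoint interiors and union equal to $R$. For $n\ge1$, the region $H_n$ is the union of the trapezoid with vertices $(0,0),(n,0),(n-\tfrac12,s),(\tfrac12,s)$ and the trapezoid with vertices $(\tfrac12,s),(n-\tfrac12,s),(n,2s),(0,2s)$ ($4n-2$ cells; for $n=1$ two unit triangles meeting at a point), and $P_n$ is $H_n$ with the cell with vertices $(n-1,0),(n,0),(n-\tfrac12,s)$ removed. Define $h_n$ (resp. $p_n$) as the sum, over all tilings of $H_n$ (resp. $P_n$), of the total number of tiles in the tiling; $\varphi_n$ (resp. $\theta_n$) as the same sum counting only small tiles; and $q_n$ (resp. $r_n$) as the same sum counting only large tiles. -}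

module Defs where

open import Data.Integer.Base as ℤ using (ℤ; +_; 0ℤ; 1ℤ)
import Data.Integer.Properties as ℤ
open import Data.List.Base
  using (List; []; _∷_; [_]; _++_; map; filter; length; upTo)
open import Data.List.Membership.Propositional using (_∈_)
open import Data.List.Membership.Propositional.Properties
  using (∈-++⁺ˡ; ∈-++⁺ʳ; ∈-map⁺; ∈-map⁻; ∈-filter⁺)
open import Data.List.Properties using (filter-all; length-map)
open import Data.List.Relation.Binary.Disjoint.Propositional using (Disjoint)
open import Data.List.Relation.Binary.Sublist.Propositional
  using (_⊆_; []; _∷_; _∷ʳ_; ⊆-refl)
open import Data.List.Relation.Binary.Sublist.Propositional.Properties
  using (++⁺ʳ)
open import Data.List.Relation.Unary.All as All using (All; []; _∷_; all?)
import Data.List.Relation.Unary.All.Properties as All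
open import Data.List.Relation.Unary.AllPairs as AllPairs
  using (AllPairs; []; _∷_; allPairs?)
import Data.List.Relation.Unary.AllPairs.Properties as AllPairs
open import Data.List.Relation.Unary.Any as Any using (Any; here; there; any?)
import Data.List.Relation.Unary.Any.Properties as Any
open import Data.List.Relation.Unary.Unique.Propositional using (Unique)
import Data.List.Relation.Unary.Unique.Propositional.Properties as Unique
open import Data.Nat.Base as ℕ using (ℕ; zero; suc; pred; NonZero)
open import Data.Nat.ListAction using (sum)
import Data.Nat.Properties as ℕ
open import Data.Product.Base using (∃-syntax; _×_; _,_)
open import Data.Rational.Base as ℚ using (ℚ; 0ℚ; ∣_∣; _-_)
open import Function.Base using (_∘_; case_of_)
open import Relation.Binary.Definitions using (DecidableEquality)
open import Relation.Binary.PropositionalEquality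
  using (_≡_; _≢_; refl; cong₂; subst)
open import Relation.Nullary.Decidable
  using (yes; no; ¬?; map′; _×-dec_)
open import Relation.Unary using (Decidable)

-- The pair (a , b) stands for the lattice point (a + b/2 , b√3/2).
-- △ a b is the cell with vertices (a , b), (a+1 , b), (a , b+1);
-- ▽ a b is the cell with vertices (a , b+1), (a+1 , b+1), (a+1 , b).

data Cell : Set where
  △ ▽ : (a b : ℤ) → Cell

infix 4 _≟_

_≟_ : DecidableEquality Cell
△ a b ≟ △ c d = map′ (λ (p , q) → cong₂ △ p q) (λ { refl → refl , refl })
                     (a ℤ.≟ c ×-dec b ℤ.≟ d)
△ _ _ ≟ ▽ _ _ = no λ ()
▽ _ _ ≟ △ _ _ = no λ ()
▽ a b ≟ ▽ c d = map′ (λ (p , q) → cong₂ ▽ p q) (λ { refl → refl , refl })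
                     (a ℤ.≟ c ×-dec b ℤ.≟ d)

open import Data.List.Membership.DecPropositional _≟_ using (_∈?_)
open import Data.List.Relation.Binary.Disjoint.DecPropositional _≟_
  using (disjoint?)

-- A large tile is named by its lower left cell if it points up and by its
-- upper right cell if it points down:
-- large (△ a b) has vertices (a , b), (a+2 , b), (a , b+2);
-- large (▽ a b) has vertices (a-1 , b+1), (a+1 , b+1), (a+1 , b-1).

data Tile : Set where
  small large : Cell → Tile

cells : Tile → List Cell
cells (small c)       = [ c ]
cells (large (△ a b)) =
  △ a b ∷ △ (a ℤ.+ 1ℤ) b ∷ △ a (b ℤ.+ 1ℤ) ∷ ▽ a b ∷ []
cells (large (▽ a b)) =
  ▽ a b ∷ ▽ (a ℤ.- 1ℤ) b ∷ ▽ a (b ℤ.- 1ℤ) ∷ △ a b ∷ []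

data IsSmall : Tile → Set where
  small : ∀ c → IsSmall (small c)

data IsLarge : Tile → Set where
  large : ∀ c → IsLarge (large c)

isSmall? : Decidable IsSmall
isSmall? (small c) = yes (small c)
isSmall? (large _) = no λ ()

isLarge? : Decidable IsLarge
isLarge? (small _) = no λ ()
isLarge? (large c) = yes (large c)

-- Regions are duplicate-free lists of cells; tilings are duplicate-free lists
-- of tiles.

Region : Set
Region = List Cell

-- Two tiles have disjoint interiors exactly when they share no cell.

IsTiling : Region → List Tile → Set
IsTiling R T =
    All (λ t → All (_∈ R) (cells t)) T
  × AllPairs (λ t u → Disjoint (cells t) (cells u)) T
  × All (λ c → Any (λ t → c ∈ cells t) T) R

isTiling? : ∀ R → Decidable (IsTiling R)
isTiling? R T =
        all? (λ t → all? (_∈? R) (cells t)) T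
  ×-dec allPairs? (λ t u → disjoint? (cells t) (cells u)) T
  ×-dec all? (λ c → any? (λ t → c ∈? cells t) T) R

-- Every tile contained in R occurs here, since it contains the cell naming it.

candidates : Region → List Tile
candidates R = map small R ++ map large R

subsets : ∀ {A : Set} → List A → List (List A)
subsets []       = [ [] ]
subsets (x ∷ xs) = map (x ∷_) (subsets xs) ++ subsets xs

tilings : Region → List (List Tile)
tilings R = filter (isTiling? R) (subsets (candidates R))

#tiles #small #large : Region → ℕ
#tiles R = sum (map length (tilings R))
#small R = sum (map (length ∘ filter isSmall?) (tilings R))
#large R = sum (map (length ∘ filter isLarge?) (tilings R))

-- The lower trapezoid has vertices (0 , 0), (n , 0), (n-1 , 1), (0 , 1) in
-- lattice coordinates, the upper one (0 , 1), (n-1 , 1), (n-1 , 2), (-1 , 2).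

lower upper : ℕ → Region
lower n = map (λ i → △ (+ i) 0ℤ) (upTo n)
       ++ map (λ i → ▽ (+ i) 0ℤ) (upTo (pred n))
upper n = map (λ i → ▽ (+ i ℤ.- 1ℤ) 1ℤ) (upTo n)
       ++ map (λ i → △ (+ i) 1ℤ) (upTo (pred n))

H P : ℕ → Region
H n = lower n ++ upper n
P n = filter (λ c → ¬? (c ≟ △ (+ n ℤ.- 1ℤ) 0ℤ)) (H n)

h φ q p θ r : ℕ → ℕ
h n = #tiles (H n)
φ n = #small (H n)
q n = #large (H n)
p n = #tiles (P n)
θ n = #small (P n)
r n = #large (P n)

-- Limits of rational sequences indexed by n ≥ 1; for a rational limit it
-- suffices to let ε range over the positive rationals.

Tendsto : ((n : ℕ) → .{{NonZero n}} → ℚ) → ℚ → Set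
Tendsto f ℓ =
  ∀ ε → 0ℚ ℚ.< ε →
  ∃[ N ] ∀ n → .{{_ : NonZero n}} → N ℕ.≤ n → ∣ f n - ℓ ∣ ℚ.< ε

-- The tiling by small tiles shows that h n and p n are nonzero for n ≥ 1.

private
  ⊆⇒∈-subsets : ∀ {A : Set} {xs ys : List A} → xs ⊆ ys → xs ∈ subsets ys
  ⊆⇒∈-subsets []                  = here refl
  ⊆⇒∈-subsets {ys = y ∷ _} (_ ∷ʳ s) = ∈-++⁺ʳ (map (y ∷_) _) (⊆⇒∈-subsets s)
  ⊆⇒∈-subsets (refl ∷ s)          = ∈-++⁺ˡ (∈-map⁺ _ (⊆⇒∈-subsets s))

  ∈⇒≤sum : ∀ {m ms} → m ∈ ms → m ℕ.≤ sum ms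
  ∈⇒≤sum (here refl)        = ℕ.m≤m+n _ _
  ∈⇒≤sum (there {x = x} m∈) = ℕ.≤-trans (∈⇒≤sum m∈) (ℕ.m≤n+m _ x)

  small-tiling : ∀ {R} → Unique R → IsTiling R (map small R)
  small-tiling {R} u =
      All.map⁺ (All.tabulate (λ c∈R → c∈R ∷ []))
    , AllPairs.map⁺ (AllPairs.map (λ { c≢d (here refl , here refl) → c≢d refl }) u)
    , All.tabulate (λ c∈R → Any.map⁺ (Any.map here c∈R))

  #tiles-nonZero : ∀ {R c} → Unique R → c ∈ R → NonZero (#tiles R)
  #tiles-nonZero {R} u c∈R = ℕ.>-nonZero (ℕ.≤-trans (positive c∈R)
    (∈⇒≤sum (∈-map⁺ length (∈-filter⁺ (isTiling? R)
      (⊆⇒∈-subsets (++⁺ʳ (map large R) ⊆-refl)) (small-tiling u)))))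
    where
    positive : ∀ {R c} → c ∈ R → 0 ℕ.< length (map small R)
    positive (here _)  = ℕ.z<s
    positive (there _) = ℕ.z<s

  maps-disjoint : ∀ {A B C : Set} {f : A → C} {g : B → C} {xs ys} →
                  (∀ x y → f x ≢ g y) → Disjoint (map f xs) (map g ys)
  maps-disjoint {f = f} {g} f≢g (v∈f , v∈g) with ∈-map⁻ f v∈f | ∈-map⁻ g v∈g
  ... | x , _ , refl | y , _ , eq = f≢g x y eq

  row : Cell → ℤ
  row (△ _ b) = b
  row (▽ _ b) = b

  lower-row : ∀ n → All (λ c → row c ≡ 0ℤ) (lower n)
  lower-row n = All.++⁺ (All.map⁺ (All.universal (λ _ → refl) (upTo n)))
                        (All.map⁺ (All.universal (λ _ → refl) (upTo (pred n))))

  upper-row : ∀ n → All (λ c → row c ≡ 1ℤ) (upper n)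
  upper-row n = All.++⁺ (All.map⁺ (All.universal (λ _ → refl) (upTo n)))
                        (All.map⁺ (All.universal (λ _ → refl) (upTo (pred n))))

H-unique : ∀ n → Unique (H n)
H-unique n = Unique.++⁺
  (Unique.++⁺ (Unique.map⁺ (λ { refl → refl }) (Unique.upTo⁺ n))
              (Unique.map⁺ (λ { refl → refl }) (Unique.upTo⁺ (pred n)))
              (maps-disjoint λ _ _ ()))
  (Unique.++⁺ (Unique.map⁺ shift-injective (Unique.upTo⁺ n))
              (Unique.map⁺ (λ { refl → refl }) (Unique.upTo⁺ (pred n)))
              (maps-disjoint λ _ _ ()))
  (λ (v∈l , v∈u) → case subst (_≡ 1ℤ) (All.lookup (lower-row n) v∈l)
                                       (All.lookup (upper-row n) v∈u) of λ ())
  where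
  shift-injective : ∀ {i j} → ▽ (+ i ℤ.- 1ℤ) 1ℤ ≡ ▽ (+ j ℤ.- 1ℤ) 1ℤ → i ≡ j
  shift-injective {zero}  {zero}  _    = refl
  shift-injective {suc _} {suc _} refl = refl

P-unique : ∀ n → Unique (P n)
P-unique n = Unique.filter⁺ _ (H-unique n)

private
  corner∈H : ∀ n → .{{NonZero n}} → ▽ (0ℤ ℤ.- 1ℤ) 1ℤ ∈ H n
  corner∈H (suc n) = ∈-++⁺ʳ (lower (suc n)) (here refl)

h-nonZero : ∀ n → .{{NonZero n}} → NonZero (h n)
h-nonZero n = #tiles-nonZero (H-unique n) (corner∈H n)

p-nonZero : ∀ n → .{{NonZero n}} → NonZero (p n)
p-nonZero n = #tiles-nonZero (P-unique n) (∈-filter⁺ _ (corner∈H n) λ ())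

{-# OPTIONS --safe #-}

-- A tiling is determined by its large tiles, which can be any pairwise disjoint
-- ones. Those in H (m + 1) are U i (up) and D i (down) for i < m, and the only
-- overlapping pairs are U i, D i and, for |i - j| = 1, U i, U j and D i, D j.
-- So the tilings of H (m + 1) correspond to the words of length m in the letters
-- U, D, "none" without UU and DD; for P (m + 1) the last letter is not U. With a
-- and b the numbers of these words, induction on m gives the total numbers of
-- large tiles exactly:
--   2 q + b = (m + 1) a   and   2 r = m b.
-- Each tiling satisfies #small + 4 #large = area, so φ - 4 q = 4 b - 2 a and
-- θ - 4 r = b, which are O(h / n) and O(p / n). Hence large tiles make up a
-- fifth of all the tiles in the limit.

module Submission where

open import Defs
open import Algebra.Bundles using (AbelianGroup)
open import Data.List.Base
  using (List; []; _∷_; _++_; map; filter; length; concat; upTo)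
open import Data.List.Membership.Propositional using (_∈_; _∉_; find; lose)
open import Data.List.Membership.Propositional.Properties
open import Data.List.Membership.Propositional.Properties.WithK
  using (unique∧set⇒bag)
open import Data.List.Properties
  using (∷-injectiveʳ; length-++; length-map; length-upTo; map-∘; map-++; map-cong; map-cong-local;
         filter-++; filter-none; filter-all; filter-accept; filter-reject)
open import Data.List.Relation.Binary.BagAndSetEquality using (∼bag⇒↭)
open import Data.List.Relation.Binary.Disjoint.Propositional using (Disjoint)
open import Data.List.Relation.Binary.Permutation.Propositional using (_↭_)
import Data.List.Relation.Binary.Permutation.Propositional.Properties as ↭
open import Data.List.Relation.Binary.Sublist.Propositional
  using (_⊆_; []; _∷_; _∷ʳ_; lookup)
import Data.List.Relation.Binary.Sublist.Propositional.Properties as ⊆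
open import Data.List.Relation.Unary.All as All using (All; []; _∷_; all?)
import Data.List.Relation.Unary.All.Properties as All
open import Data.List.Relation.Unary.AllPairs as AllPairs
  using (AllPairs; []; _∷_; allPairs?)
import Data.List.Relation.Unary.AllPairs.Properties as AllPairs
open import Data.List.Relation.Unary.Any as Any using (Any; here; there; any?)
import Data.List.Relation.Unary.Any.Properties as Any
open import Data.List.Relation.Unary.Unique.Propositional using (Unique)
import Data.List.Relation.Unary.Unique.Propositional.Properties as Unique
open import Data.Nat.Base hiding (_/_)
open import Data.Nat.ListAction using (sum)
open import Data.Nat.ListAction.Properties using (sum-++; sum-↭)
open import Data.Nat.Properties hiding (_≟_)
open import Algebra.Properties.CommutativeSemigroup +-commutativeSemigroup
  using (x∙yz≈y∙xz; interchange)
open import Data.Nat.Tactic.RingSolver using (solve-∀)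
open import Data.Integer.Base as ℤ using (ℤ; +_; +[1+_]; 0ℤ; 1ℤ)
import Data.Integer.Properties as ℤ
open import Algebra.Properties.Group (AbelianGroup.group ℤ.+-0-abelianGroup)
  using (identityʳ-unique)
open import Data.Product.Base using (_×_; _,_; proj₁; proj₂; ∃-syntax)
open import Data.Rational.Base as ℚ using (0ℚ; _/_; ↧ₙ_; mkℚ)
import Data.Rational.Properties as ℚ
open import Data.Rational.Unnormalised.Base as ℚᵘ using (mkℚᵘ; *<*)
import Data.Rational.Unnormalised.Properties as ℚᵘ
open import Data.Sum.Base using (_⊎_; inj₁; inj₂)
open import Function.Base using (_∘_; case_of_)
open import Function.Bundles using (mk⇔)
open import Level using (0ℓ)
open import Relation.Binary.Core using (Rel)
open import Relation.Binary.Definitions using (Symmetric; DecidableEquality)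
  renaming (Decidable to Decidable₂)
open import Relation.Binary.PropositionalEquality
open import Relation.Nullary.Decidable
  using (yes; no; ¬?; map′)
open import Relation.Nullary.Negation using (¬_; contradiction)
open import Relation.Unary using (Pred; Decidable)

open import Data.List.Membership.DecPropositional _≟_ using (_∈?_)
open import Data.List.Relation.Binary.Disjoint.DecPropositional _≟_
  using (disjoint?)

-- Duplicate-free lists, sublists and `subsets`.

module _ {A : Set} where

  unique∧set⇒↭ : {xs ys : List A} → Unique xs → Unique ys →
                 (∀ {z} → z ∈ xs → z ∈ ys) → (∀ {z} → z ∈ ys → z ∈ xs) → xs ↭ ys
  unique∧set⇒↭ ux uy f g = ∼bag⇒↭ (unique∧set⇒bag ux uy (mk⇔ f g))

  -- In a duplicate-free list, pairs of positions are pairs of distinct elements. Together with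
  -- `AllPairs-lookup` this moves pairwise disjointness between lists that order their tiles
  -- differently.
  AllPairs-tabulate : {R : Rel A 0ℓ} {xs : List A} → Unique xs →
    (∀ {x y} → x ∈ xs → y ∈ xs → x ≢ y → R x y) → AllPairs R xs
  AllPairs-tabulate []       f = []
  AllPairs-tabulate (x∉ ∷ u) f =
      All.tabulate (λ y∈ → f (here refl) (there y∈) (All.lookup x∉ y∈))
    ∷ AllPairs-tabulate u λ x∈ y∈ → f (there x∈) (there y∈)

  AllPairs-lookup : {R : Rel A 0ℓ} {xs : List A} → Symmetric R → AllPairs R xs →
    ∀ {x y} → x ∈ xs → y ∈ xs → x ≢ y → R x y
  AllPairs-lookup s (_  ∷ _)  (here refl) (here refl) x≢y = contradiction refl x≢y
  AllPairs-lookup s (px ∷ _)  (here refl) (there y∈)  _   = All.lookup px y∈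
  AllPairs-lookup s (px ∷ _)  (there x∈)  (here refl) _   = s (All.lookup px x∈)
  AllPairs-lookup s (_  ∷ ps) (there x∈)  (there y∈)  x≢y = AllPairs-lookup s ps x∈ y∈ x≢y

  AllPairs-⊆ : {R : Rel A 0ℓ} {xs ys : List A} → xs ⊆ ys → AllPairs R ys → AllPairs R xs
  AllPairs-⊆ []         []       = []
  AllPairs-⊆ (_ ∷ʳ s)   (_ ∷ ps) = AllPairs-⊆ s ps
  AllPairs-⊆ (refl ∷ s) (p ∷ ps) = ⊆.All-resp-⊆ s p ∷ AllPairs-⊆ s ps

  -- Injectivity is asked on `xs` only: `larges` forgets small tiles, so it is injective on tilings
  -- but not on all lists of tiles.
  Unique-map-∈ : {B : Set} {f : A → B} {xs : List A} → Unique xs →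
    (∀ {x y} → x ∈ xs → y ∈ xs → f x ≡ f y → x ≡ y) → Unique (map f xs)
  Unique-map-∈ u inj =
    AllPairs.map⁺ (AllPairs-tabulate u λ x∈ y∈ x≢y → x≢y ∘ inj x∈ y∈)

  -- Where only one sublist keeps the head of `zs`, that head would also lie in the other one, hence
  -- in the tail of `zs`. This makes two tilings, both sublists of `candidates R`, equal as soon as
  -- they have the same tiles.
  ⊆-antisym-∈ : {xs ys zs : List A} → Unique zs → xs ⊆ zs → ys ⊆ zs →
    (∀ {z} → z ∈ xs → z ∈ ys) → (∀ {z} → z ∈ ys → z ∈ xs) → xs ≡ ys
  ⊆-antisym-∈ []       []         []         f g = refl
  ⊆-antisym-∈ (z∉ ∷ u) (_ ∷ʳ s)   (_ ∷ʳ t)   f g = ⊆-antisym-∈ u s t f g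
  ⊆-antisym-∈ (z∉ ∷ u) (_ ∷ʳ s)   (refl ∷ t) f g =
    contradiction refl (All.lookup z∉ (lookup s (g (here refl))))
  ⊆-antisym-∈ (z∉ ∷ u) (refl ∷ s) (_ ∷ʳ t)   f g =
    contradiction refl (All.lookup z∉ (lookup t (f (here refl))))
  ⊆-antisym-∈ (z∉ ∷ u) (refl ∷ s) (refl ∷ t) f g =
    cong (_ ∷_) (⊆-antisym-∈ u s t (drop s f) (drop t g))
    where
    drop : ∀ {us vs} → us ⊆ _ → (∀ {z} → z ∈ _ ∷ us → z ∈ _ ∷ vs) →
           ∀ {z} → z ∈ us → z ∈ vs
    drop s h z∈ with h (there z∈)
    ... | here refl = contradiction refl (All.lookup z∉ (lookup s z∈))
    ... | there z∈′ = z∈′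

  ∈-subsets⁺ : {xs ys : List A} → xs ⊆ ys → xs ∈ subsets ys
  ∈-subsets⁺ []                      = here refl
  ∈-subsets⁺ {ys = y ∷ _} (_ ∷ʳ s)   = ∈-++⁺ʳ (map (y ∷_) _) (∈-subsets⁺ s)
  ∈-subsets⁺              (refl ∷ s) = ∈-++⁺ˡ (∈-map⁺ _ (∈-subsets⁺ s))

  ∈-subsets⁻ : {xs ys : List A} → xs ∈ subsets ys → xs ⊆ ys
  ∈-subsets⁻ {ys = []}     (here refl) = []
  ∈-subsets⁻ {ys = y ∷ ys} xs∈ with ∈-++⁻ (map (y ∷_) (subsets ys)) xs∈
  ... | inj₂ xs∈′ = y ∷ʳ ∈-subsets⁻ xs∈′
  ... | inj₁ xs∈′ with ∈-map⁻ (y ∷_) xs∈′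
  ...   | _ , zs∈ , refl = refl ∷ ∈-subsets⁻ zs∈

  subsets-unique : {xs : List A} → Unique xs → Unique (subsets xs)
  subsets-unique []                 = [] ∷ []
  subsets-unique {x ∷ _} (x∉ ∷ u) =
    Unique.++⁺ (Unique.map⁺ ∷-injectiveʳ (subsets-unique u)) (subsets-unique u)
      λ (v∈₁ , v∈₂) → case-∷ v∈₁ v∈₂
    where
    case-∷ : ∀ {v} → v ∈ map (x ∷_) _ → v ∉ _
    case-∷ v∈₁ v∈₂ with ∈-map⁻ (x ∷_) v∈₁
    ... | _ , _ , refl =
      All.lookup x∉ (lookup (∈-subsets⁻ v∈₂) (here refl)) refl

  filter-map-≐ : {B : Set} {P : Pred A 0ℓ} {Q : Pred B 0ℓ}
    (P? : Decidable P) (Q? : Decidable Q) {f : A → B} →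
    (∀ x → P x → Q (f x)) → (∀ x → Q (f x) → P x) →
    ∀ xs → filter Q? (map f xs) ≡ map f (filter P? xs)
  filter-map-≐ P? Q? to from []       = refl
  filter-map-≐ P? Q? {f} to from (x ∷ xs) with P? x
  ... | yes p = trans (filter-accept Q? (to x p))
                      (cong (f x ∷_) (filter-map-≐ P? Q? to from xs))
  ... | no ¬p = trans (filter-reject Q? (¬p ∘ from x)) (filter-map-≐ P? Q? to from xs)

  sum-map-suc : (f : A → ℕ) (xs : List A) →
    sum (map (suc ∘ f) xs) ≡ length xs + sum (map f xs)
  sum-map-suc f []       = refl
  sum-map-suc f (x ∷ xs) = cong suc (trans (cong (_+_ (f x)) (sum-map-suc f xs))
    (x∙yz≈y∙xz (f x) (length xs) (sum (map f xs))))

-- Counting the independent sets of a graph by deleting a vertex: those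
-- avoiding x live on the remaining vertices, those containing x on the
-- non-neighbours of x.

module Independent {A : Set} {_#_ : Rel A 0ℓ} (_#?_ : Decidable₂ _#_) where

  independent : List A → List (List A)
  independent = filter (allPairs? _#?_) ∘ subsets

  ν κ : List A → ℕ
  ν xs = length (independent xs)
  κ xs = sum (map length (independent xs))

  ∈-independent⁺ : ∀ {xs ys} → xs ⊆ ys → AllPairs _#_ xs → xs ∈ independent ys
  ∈-independent⁺ s = ∈-filter⁺ (allPairs? _#?_) (∈-subsets⁺ s)

  ∈-independent⁻ : ∀ {xs ys} → xs ∈ independent ys → xs ⊆ ys × AllPairs _#_ xs
  ∈-independent⁻ {ys = ys} xs∈ with ∈-filter⁻ (allPairs? _#?_) {xs = subsets ys} xs∈
  ... | xs∈′ , ps = ∈-subsets⁻ xs∈′ , ps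

  independent-unique : ∀ {xs} → Unique xs → Unique (independent xs)
  independent-unique u = Unique.filter⁺ (allPairs? _#?_) (subsets-unique u)

  filter-subsets : ∀ {P : Pred A 0ℓ} (P? : Decidable P) xs →
    filter (all? P?) (subsets xs) ≡ subsets (filter P? xs)
  filter-subsets P? [] = refl
  filter-subsets P? (y ∷ xs) with P? y
  ... | no ¬p =
    trans (filter-++ (all? P?) (map (y ∷_) (subsets xs)) (subsets xs))
      (cong₂ _++_
        (filter-none (all? P?) (All.map⁺ (All.universal (λ { _ (p ∷ _) → ¬p p }) (subsets xs))))
        (filter-subsets P? xs))
  ... | yes p =
    trans (filter-++ (all? P?) (map (y ∷_) (subsets xs)) (subsets xs))
      (cong₂ _++_
        (trans (filter-map-≐ (all? P?) (all? P?) (λ _ → p ∷_) (λ { _ (_ ∷ ps) → ps }) (subsets xs))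
               (cong (map (y ∷_)) (filter-subsets P? xs)))
        (filter-subsets P? xs))

  filter-allPairs-∷ : ∀ x yss →
    filter (allPairs? _#?_) (map (x ∷_) yss)
      ≡ map (x ∷_) (filter (allPairs? _#?_) (filter (all? (x #?_)) yss))
  filter-allPairs-∷ x []         = refl
  filter-allPairs-∷ x (ys ∷ yss) with all? (x #?_) ys
  ... | no _  = filter-allPairs-∷ x yss
  ... | yes _ with allPairs? _#?_ ys
  ...   | no _  = filter-allPairs-∷ x yss
  ...   | yes _ = cong ((x ∷ ys) ∷_) (filter-allPairs-∷ x yss)

  -- Stated for the lists themselves rather than their lengths, so that `ν-∷` and `κ-∷` can both be
  -- read off.
  independent-∷ : ∀ x xs →
    independent (x ∷ xs) ≡ map (x ∷_) (independent (filter (x #?_) xs)) ++ independent xs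
  independent-∷ x xs =
    trans (filter-++ (allPairs? _#?_) (map (x ∷_) (subsets xs)) (subsets xs))
      (cong (_++ independent xs)
        (trans (filter-allPairs-∷ x (subsets xs))
               (cong (map (x ∷_) ∘ filter (allPairs? _#?_)) (filter-subsets (x #?_) xs))))

  ν-∷ : ∀ x xs → ν (x ∷ xs) ≡ ν (filter (x #?_) xs) + ν xs
  ν-∷ x xs = begin
    ν (x ∷ xs)                                    ≡⟨ cong length (independent-∷ x xs) ⟩
    length (map (x ∷_) I ++ independent xs)       ≡⟨ length-++ (map (x ∷_) I) ⟩
    length (map (x ∷_) I) + ν xs                  ≡⟨ cong (_+ ν xs) (length-map (x ∷_) I) ⟩
    ν (filter (x #?_) xs) + ν xs                  ∎
    where
    open ≡-Reasoning
    I = independent (filter (x #?_) xs)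

  -- The extra `ν` counts `x` itself, once for each independent set containing it.
  κ-∷ : ∀ x xs → κ (x ∷ xs) ≡ (ν (filter (x #?_) xs) + κ (filter (x #?_) xs)) + κ xs
  κ-∷ x xs = begin
    κ (x ∷ xs)
      ≡⟨ cong (sum ∘ map length) (independent-∷ x xs) ⟩
    sum (map length (map (x ∷_) I ++ independent xs))
      ≡⟨ cong sum (map-++ length (map (x ∷_) I) (independent xs)) ⟩
    sum (map length (map (x ∷_) I) ++ map length (independent xs))
      ≡⟨ sum-++ (map length (map (x ∷_) I)) _ ⟩
    sum (map length (map (x ∷_) I)) + κ xs
      ≡⟨ cong (λ l → sum l + κ xs) (map-∘ I) ⟨
    sum (map (suc ∘ length) I) + κ xs
      ≡⟨ cong (_+ κ xs) (sum-map-suc length I) ⟩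
    (ν (filter (x #?_) xs) + κ (filter (x #?_) xs)) + κ xs ∎
    where
    open ≡-Reasoning
    I = independent (filter (x #?_) xs)

-- Overlap of tiles, and the area of a tiling.

infix 4 _≟ᵗ_ _#_ _#?_

_≟ᵗ_ : DecidableEquality Tile
small c ≟ᵗ small d = map′ (cong small) (λ { refl → refl }) (c ≟ d)
small _ ≟ᵗ large _ = no λ ()
large _ ≟ᵗ small _ = no λ ()
large c ≟ᵗ large d = map′ (cong large) (λ { refl → refl }) (c ≟ d)

open import Data.List.Membership.DecPropositional _≟ᵗ_ using () renaming (_∈?_ to _∈ᵗ?_)

_#_ : Rel Tile 0ℓ
t # u = Disjoint (cells t) (cells u)

_#?_ : Decidable₂ _#_
t #? u = disjoint? (cells t) (cells u)

open Independent _#?_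

#-sym : Symmetric _#_
#-sym t#u (v∈u , v∈t) = t#u (v∈t , v∈u)

Inside : Region → Tile → Set
Inside R t = All (_∈ R) (cells t)

name∈cells : ∀ c → c ∈ cells (large c)
name∈cells (△ _ _) = here refl
name∈cells (▽ _ _) = here refl

abscissa ordinate : Cell → ℤ
abscissa (△ a b) = a
abscissa (▽ a b) = a
ordinate (△ a b) = b
ordinate (▽ a b) = b

-- Makes the length of `cells t` the area of `t`. Distinct cells of the same orientation in a large
-- tile differ by one in some coordinate; `identityʳ-unique` would force that difference to be zero.
cells-unique : ∀ t → Unique (cells t)
cells-unique (small c)       = [] ∷ []
cells-unique (large (△ a b)) =
  (△≢△ˡ ∷ △≢△ʳ ∷ (λ ()) ∷ []) ∷ (△≢△ˡʳ ∷ (λ ()) ∷ []) ∷ ((λ ()) ∷ []) ∷ [] ∷ []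
  where
  △≢△ˡ : △ a b ≢ △ (a ℤ.+ 1ℤ) b
  △≢△ˡ eq = contradiction (identityʳ-unique a 1ℤ (sym (cong abscissa eq))) λ ()
  △≢△ʳ : △ a b ≢ △ a (b ℤ.+ 1ℤ)
  △≢△ʳ eq = contradiction (identityʳ-unique b 1ℤ (sym (cong ordinate eq))) λ ()
  △≢△ˡʳ : △ (a ℤ.+ 1ℤ) b ≢ △ a (b ℤ.+ 1ℤ)
  △≢△ˡʳ eq = contradiction (identityʳ-unique a 1ℤ (cong abscissa eq)) λ ()
cells-unique (large (▽ a b)) =
  (▽≢▽ˡ ∷ ▽≢▽ʳ ∷ (λ ()) ∷ []) ∷ (▽≢▽ˡʳ ∷ (λ ()) ∷ []) ∷ ((λ ()) ∷ []) ∷ [] ∷ []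
  where
  ▽≢▽ˡ : ▽ a b ≢ ▽ (a ℤ.- 1ℤ) b
  ▽≢▽ˡ eq = contradiction (identityʳ-unique a (ℤ.- 1ℤ) (sym (cong abscissa eq))) λ ()
  ▽≢▽ʳ : ▽ a b ≢ ▽ a (b ℤ.- 1ℤ)
  ▽≢▽ʳ eq = contradiction (identityʳ-unique b (ℤ.- 1ℤ) (sym (cong ordinate eq))) λ ()
  ▽≢▽ˡʳ : ▽ (a ℤ.- 1ℤ) b ≢ ▽ a (b ℤ.- 1ℤ)
  ▽≢▽ˡʳ eq = contradiction (identityʳ-unique a (ℤ.- 1ℤ) (cong abscissa eq)) λ ()

candidates-unique : ∀ {R} → Unique R → Unique (candidates R)
candidates-unique u =
  Unique.++⁺ (Unique.map⁺ (λ { refl → refl }) u) (Unique.map⁺ (λ { refl → refl }) u)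
    λ (v∈s , v∈l) → case ∈-map⁻ small v∈s , ∈-map⁻ large v∈l of λ
      { ((_ , _ , refl) , (_ , _ , ())) }

∈-tilings⁻ : ∀ {R T} → T ∈ tilings R → T ⊆ candidates R × IsTiling R T
∈-tilings⁻ {R} T∈ with ∈-filter⁻ (isTiling? R) {xs = subsets (candidates R)} T∈
... | T∈′ , tiling = ∈-subsets⁻ T∈′ , tiling

∈-tilings⁺ : ∀ {R T} → T ⊆ candidates R → IsTiling R T → T ∈ tilings R
∈-tilings⁺ {R} s = ∈-filter⁺ (isTiling? R) (∈-subsets⁺ s)

tilings-unique : ∀ {R} → Unique R → Unique (tilings R)
tilings-unique {R} u = Unique.filter⁺ (isTiling? R) (subsets-unique (candidates-unique u))

overlap⇒≡ : ∀ {T t u c} → AllPairs _#_ T → t ∈ T → u ∈ T →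
            c ∈ cells t → c ∈ cells u → t ≡ u
overlap⇒≡ {t = t} {u} ps t∈ u∈ c∈t c∈u with t ≟ᵗ u
... | yes t≡u = t≡u
... | no  t≢u = contradiction (c∈t , c∈u) (AllPairs-lookup (λ {x} {y} → #-sym {x} {y}) ps t∈ u∈ t≢u)

length-concat-cells : ∀ T →
  length (concat (map cells T)) ≡
  length (filter isSmall? T) + 4 * length (filter isLarge? T)
length-concat-cells []            = refl
length-concat-cells (small c ∷ T) = cong suc (length-concat-cells T)
length-concat-cells (large (△ a b) ∷ T) =
  trans (cong (_+_ 4) (length-concat-cells T)) (lemma _ _)
  where
  lemma : ∀ s l → 4 + (s + 4 * l) ≡ s + 4 * suc l
  lemma = solve-∀
length-concat-cells (large (▽ a b) ∷ T) =
  trans (cong (_+_ 4) (length-concat-cells T)) (lemma _ _)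
  where
  lemma : ∀ s l → 4 + (s + 4 * l) ≡ s + 4 * suc l
  lemma = solve-∀

length-small+large : ∀ T → length T ≡ length (filter isSmall? T) + length (filter isLarge? T)
length-small+large []            = refl
length-small+large (small c ∷ T) = cong suc (length-small+large T)
length-small+large (large c ∷ T) = trans (cong suc (length-small+large T)) (sym (+-suc _ _))

-- The concatenated cells of `T` enumerate `R` without repetition: disjointness excludes
-- repetitions, containment and covering give the same set of cells.
tiling-area : ∀ {R T} → Unique R → T ∈ tilings R →
  length (filter isSmall? T) + 4 * length (filter isLarge? T) ≡ length R
tiling-area {R} {T} u T∈ with ∈-tilings⁻ {R} T∈
... | _ , inside , ps , cover = trans (sym (length-concat-cells T))
  (↭.↭-length (unique∧set⇒↭
    (Unique.concat⁺ (All.map⁺ (All.universal cells-unique T)) (AllPairs.map⁺ ps)) u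
    (λ c∈ → All.lookupWith (λ ins c∈t → All.lookup ins c∈t) inside
      (Any.map⁻ (∈-concat⁻ (map cells T) c∈)))
    (λ c∈R → ∈-concat⁺ (Any.map⁺ (All.lookup cover c∈R)))))

sum-map-+ : {A : Set} (f g : A → ℕ) (xs : List A) →
  sum (map (λ x → f x + g x) xs) ≡ sum (map f xs) + sum (map g xs)
sum-map-+ f g []       = refl
sum-map-+ f g (x ∷ xs) rewrite sum-map-+ f g xs = interchange (f x) (g x) _ _

sum-map-* : {A : Set} (k : ℕ) (f : A → ℕ) (xs : List A) →
  sum (map (λ x → k * f x) xs) ≡ k * sum (map f xs)
sum-map-* k f []       = sym (*-zeroʳ k)
sum-map-* k f (x ∷ xs) rewrite sum-map-* k f xs = sym (*-distribˡ-+ k (f x) _)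

sum-map-const : {A : Set} (k : ℕ) (xs : List A) → sum (map (λ _ → k) xs) ≡ length xs * k
sum-map-const k []       = refl
sum-map-const k (x ∷ xs) = cong (_+_ k) (sum-map-const k xs)

#tiles≡#small+#large : ∀ R → #tiles R ≡ #small R + #large R
#tiles≡#small+#large R =
  trans (cong sum (map-cong length-small+large (tilings R)))
        (sum-map-+ _ _ (tilings R))

#small+4#large : ∀ {R} → Unique R → #small R + 4 * #large R ≡ length (tilings R) * length R
#small+4#large {R} u = begin
  #small R + 4 * #large R
    ≡⟨ cong (_+_ (#small R)) (sum-map-* 4 _ (tilings R)) ⟨
  #small R + sum (map (λ T → 4 * length (filter isLarge? T)) (tilings R))
    ≡⟨ sum-map-+ _ _ (tilings R) ⟨
  sum (map (λ T → length (filter isSmall? T) + 4 * length (filter isLarge? T)) (tilings R))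
    ≡⟨ cong sum (map-cong-local (All.tabulate (tiling-area u))) ⟩
  sum (map (λ _ → length R) (tilings R))
    ≡⟨ sum-map-const (length R) (tilings R) ⟩
  length (tilings R) * length R ∎
  where open ≡-Reasoning

-- Tilings of `R` correspond to independent sets of its large tiles, enumerated by `V`.

module _ {R : Region} {V : List Tile} (R! : Unique R) (V! : Unique V)
         (V⁻ : ∀ {t} → t ∈ V → IsLarge t × Inside R t)
         (V⁺ : ∀ {t} → IsLarge t → Inside R t → t ∈ V) where

  -- Filtering `V` by membership in `T`, rather than `T` by size, yields a sublist in the order of
  -- `V`, like the members of `independent V`.
  larges : List Tile → List Tile
  larges T = filter (_∈ᵗ? T) V

  ∈-larges⁻ : ∀ T {t} → t ∈ larges T → t ∈ T
  ∈-larges⁻ T t∈ = proj₂ (∈-filter⁻ (_∈ᵗ? T) {xs = V} t∈)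

  large∈larges : ∀ {T c} → IsTiling R T → large c ∈ T → large c ∈ larges T
  large∈larges {T} (inside , _) t∈ =
    ∈-filter⁺ (_∈ᵗ? T) (V⁺ (large _) (All.lookup inside t∈)) t∈

  larges-independent : ∀ {T} → T ∈ tilings R → larges T ∈ independent V
  larges-independent {T} T∈ with ∈-tilings⁻ {R} T∈
  ... | _ , _ , ps , _ = ∈-independent⁺ (⊆.filter-⊆ (_∈ᵗ? T) V)
    (AllPairs-tabulate (Unique.filter⁺ (_∈ᵗ? T) V!)
      λ t∈ u∈ → AllPairs-lookup (λ {x} {y} → #-sym {x} {y}) ps (∈-larges⁻ T t∈) (∈-larges⁻ T u∈))

  -- The tile of `T′` covering the cell of a small tile `small c` of `T` cannot be large: it would
  -- then belong to `T` as well and overlap `small c` there.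
  larges-determine : ∀ {T T′} → IsTiling R T → IsTiling R T′ → larges T ≡ larges T′ →
                     ∀ {t} → t ∈ T → t ∈ T′
  larges-determine {T} {T′} tiling _ eq {large c} t∈ =
    ∈-larges⁻ T′ (subst (large c ∈_) eq (large∈larges tiling t∈))
  larges-determine {T} {T′} tiling@(inside , ps , _) tiling′@(_ , _ , cover′) eq {small c} t∈
    with find (All.lookup cover′ (All.lookup (All.lookup inside t∈) (here refl)))
  ... | small _ , t′∈ , here refl = t′∈
  ... | large c′ , t′∈ , c∈t′
    with overlap⇒≡ ps t∈ (larges-determine tiling′ tiling (sym eq) t′∈) (here refl) c∈t′
  ...   | ()

  larges-injective : ∀ {T T′} → T ∈ tilings R → T′ ∈ tilings R → larges T ≡ larges T′ → T ≡ T′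
  larges-injective T∈ T′∈ eq with ∈-tilings⁻ {R} T∈ | ∈-tilings⁻ {R} T′∈
  ... | s , tiling | s′ , tiling′ = ⊆-antisym-∈ (candidates-unique R!) s s′
    (larges-determine tiling tiling′ eq) (larges-determine tiling′ tiling (sym eq))

  -- The inverse of `larges`: every cell left uncovered by `I` becomes a small tile.
  module Complete {I} (I∈ : I ∈ independent V) where

    I⊆V : I ⊆ V
    I⊆V = proj₁ (∈-independent⁻ I∈)

    I-disjoint : AllPairs _#_ I
    I-disjoint = proj₂ (∈-independent⁻ {ys = V} I∈)

    covered? : Decidable (λ c → Any (λ t → c ∈ cells t) I)
    covered? c = any? (λ t → c ∈? cells t) I

    -- The large tiles are listed in the order of `R`, not of `I`, to obtain a sublist of
    -- `candidates R`. None is lost, since the cell naming a tile of `I` lies in `R`.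
    complete : List Tile
    complete = map small (filter (¬? ∘ covered?) R) ++ map large (filter (λ c → large c ∈ᵗ? I) R)

    complete-⊆ : complete ⊆ candidates R
    complete-⊆ = ⊆.++⁺ (⊆.map⁺ small (⊆.filter-⊆ _ R)) (⊆.map⁺ large (⊆.filter-⊆ _ R))

    small∈complete : ∀ {c} → c ∈ R → ¬ Any (λ t → c ∈ cells t) I → small c ∈ complete
    small∈complete c∈R ¬cov = ∈-++⁺ˡ (∈-map⁺ small (∈-filter⁺ (¬? ∘ covered?) c∈R ¬cov))

    I⊆complete : ∀ {t} → t ∈ I → t ∈ complete
    I⊆complete t∈ with V⁻ (lookup I⊆V t∈)
    ... | large c , inside =
      ∈-++⁺ʳ _ (∈-map⁺ large (∈-filter⁺ _ (All.lookup inside (name∈cells c)) t∈))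

    small∈complete⁻ : ∀ {c} → small c ∈ complete → c ∈ R × ¬ Any (λ t → c ∈ cells t) I
    small∈complete⁻ t∈ with ∈-++⁻ (map small (filter (¬? ∘ covered?) R)) t∈
    ... | inj₁ t∈′ with ∈-map⁻ small t∈′
    ...   | _ , c∈ , refl = ∈-filter⁻ (¬? ∘ covered?) {xs = R} c∈
    small∈complete⁻ t∈ | inj₂ t∈′ with ∈-map⁻ large t∈′
    ...   | _ , _ , ()

    large∈complete⁻ : ∀ {c} → large c ∈ complete → large c ∈ I
    large∈complete⁻ t∈ with ∈-++⁻ (map small (filter (¬? ∘ covered?) R)) t∈
    ... | inj₂ t∈′ with ∈-map⁻ large t∈′
    ...   | _ , c∈ , refl = proj₂ (∈-filter⁻ (λ c → large c ∈ᵗ? I) {xs = R} c∈)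
    large∈complete⁻ t∈ | inj₁ t∈′ with ∈-map⁻ small t∈′
    ...   | _ , _ , ()

    complete-inside : ∀ {t} → t ∈ complete → Inside R t
    complete-inside {small c} t∈ = proj₁ (small∈complete⁻ t∈) ∷ []
    complete-inside {large c} t∈ = proj₂ (V⁻ (lookup I⊆V (large∈complete⁻ t∈)))

    complete-disjoint : ∀ {t u} → t ∈ complete → u ∈ complete → t ≢ u → t # u
    complete-disjoint {small c} {small d} _  _  t≢u (here refl , here refl) = t≢u refl
    complete-disjoint {small c} {large d} t∈ u∈ _   (here refl , c∈u) =
      proj₂ (small∈complete⁻ t∈) (lose (large∈complete⁻ u∈) c∈u)
    complete-disjoint {large c} {small d} t∈ u∈ _   (d∈t , here refl) =
      proj₂ (small∈complete⁻ u∈) (lose (large∈complete⁻ t∈) d∈t)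
    complete-disjoint {large c} {large d} t∈ u∈ t≢u =
      AllPairs-lookup (λ {x} {y} → #-sym {x} {y}) I-disjoint
        (large∈complete⁻ t∈) (large∈complete⁻ u∈) t≢u

    complete-cover : ∀ {c} → c ∈ R → Any (λ t → c ∈ cells t) complete
    complete-cover {c} c∈R with covered? c
    ... | no ¬cov = lose (small∈complete c∈R ¬cov) (here refl)
    ... | yes cov with find cov
    ...   | t , t∈ , c∈t = lose (I⊆complete t∈) c∈t

    complete∈tilings : complete ∈ tilings R
    complete∈tilings = ∈-tilings⁺ {R} complete-⊆
      ( All.tabulate complete-inside
      , AllPairs-tabulate (AllPairs-⊆ complete-⊆ (candidates-unique R!)) complete-disjoint
      , All.tabulate complete-cover)

    larges-complete : I ≡ larges complete
    larges-complete = ⊆-antisym-∈ V! I⊆V (⊆.filter-⊆ _ V)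
      (λ t∈ → ∈-filter⁺ (_∈ᵗ? complete) (lookup I⊆V t∈) (I⊆complete t∈))
      (λ t∈ → back (∈-filter⁻ (_∈ᵗ? complete) {xs = V} t∈))
      where
      back : ∀ {t} → t ∈ V × t ∈ complete → t ∈ I
      back (t∈V , t∈) with V⁻ t∈V
      ... | large c , _ = large∈complete⁻ t∈

  -- The two lists may be ordered differently, but `ν` and `κ` only take lengths and sums.
  tilings↭independent : map larges (tilings R) ↭ independent V
  tilings↭independent = unique∧set⇒↭
    (Unique-map-∈ (tilings-unique R!) larges-injective) (independent-unique V!) to from
    where
    to : ∀ {I} → I ∈ map larges (tilings R) → I ∈ independent V
    to I∈ with ∈-map⁻ larges I∈
    ... | _ , T∈ , refl = larges-independent T∈
    from : ∀ {I} → I ∈ independent V → I ∈ map larges (tilings R)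
    from I∈ = subst (_∈ map larges (tilings R)) (sym (Complete.larges-complete I∈))
      (∈-map⁺ larges (Complete.complete∈tilings I∈))

  length-tilings : length (tilings R) ≡ ν V
  length-tilings = trans (sym (length-map larges (tilings R))) (↭.↭-length tilings↭independent)

  length-larges : ∀ {T} → T ∈ tilings R → length (filter isLarge? T) ≡ length (larges T)
  length-larges {T} T∈ with ∈-tilings⁻ {R} T∈
  ... | s , tiling = ↭.↭-length (unique∧set⇒↭
    (Unique.filter⁺ isLarge? (AllPairs-⊆ s (candidates-unique R!))) (Unique.filter⁺ (_∈ᵗ? T) V!)
    to λ t∈ → ∈-filter⁺ isLarge? (∈-larges⁻ T t∈)
      (proj₁ (V⁻ (proj₁ (∈-filter⁻ (_∈ᵗ? T) {xs = V} t∈)))))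
    where
    to : ∀ {t} → t ∈ filter isLarge? T → t ∈ larges T
    to t∈ with ∈-filter⁻ isLarge? {xs = T} t∈
    ... | t∈T , large _ = large∈larges tiling t∈T

  #large≡κ : #large R ≡ κ V
  #large≡κ = begin
    sum (map (length ∘ filter isLarge?) (tilings R))
      ≡⟨ cong sum (map-cong-local (All.tabulate length-larges)) ⟩
    sum (map (length ∘ larges) (tilings R))
      ≡⟨ cong sum (map-∘ (tilings R)) ⟩
    sum (map length (map larges (tilings R)))
      ≡⟨ sum-↭ (↭.map⁺ length tilings↭independent) ⟩
    κ V ∎
    where open ≡-Reasoning

-- The large tiles of the strip and their overlaps.

U D : ℕ → Tile
U i = large (△ (+ i) 0ℤ)
D i = large (▽ (+ i) 1ℤ)

-- Two of the three barycentric coordinates of a cell; they separate all the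
-- disjoint pairs among the tiles U i, D i.

coabscissa : Cell → ℤ
coabscissa (△ a b) = a ℤ.+ b
coabscissa (▽ a b) = a ℤ.+ b ℤ.+ 1ℤ

separated : (f : Cell → ℤ) (k : ℤ) → ∀ {t u} →
  All (λ c → k ℤ.≤ f c) (cells t) → All (λ c → f c ℤ.< k) (cells u) → t # u
separated f k t≥ u< (v∈t , v∈u) = ℤ.<⇒≱ (All.lookup u< v∈u) (All.lookup t≥ v∈t)

U-abscissa≥ : ∀ i → All (λ c → + i ℤ.≤ abscissa c) (cells (U i))
U-abscissa≥ i = ℤ.≤-refl ∷ ℤ.+≤+ (m≤m+n i 1) ∷ ℤ.≤-refl ∷ ℤ.≤-refl ∷ []

D-abscissa< : ∀ i → All (λ c → abscissa c ℤ.< + suc i) (cells (D i))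
D-abscissa< i = ℤ.+<+ ≤-refl ∷ pred< i ∷ ℤ.+<+ ≤-refl ∷ ℤ.+<+ ≤-refl ∷ []
  where
  pred< : ∀ i → + i ℤ.- 1ℤ ℤ.< + suc i
  pred< zero    = ℤ.-<+
  pred< (suc i) = ℤ.+<+ (m≤n⇒m≤1+n ≤-refl)

map-coabscissa-U : ∀ i →
  map coabscissa (cells (U i)) ≡ + i ∷ + suc i ∷ + suc i ∷ + suc i ∷ []
map-coabscissa-U i
  rewrite +-identityʳ (i + 1) | +-identityʳ i | +-comm i 1 = refl

-- The split on `i` lets `+ i ℤ.- 1ℤ` compute.
map-coabscissa-D : ∀ i →
  map coabscissa (cells (D i)) ≡ + suc (suc i) ∷ + suc i ∷ + suc i ∷ + suc i ∷ []
map-coabscissa-D zero    = refl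
map-coabscissa-D (suc i)
  rewrite +-identityʳ i | +-comm i 1 | +-comm i 1 = refl

U-coabscissa≥ : ∀ i → All (λ c → + i ℤ.≤ coabscissa c) (cells (U i))
U-coabscissa≥ i = All.map⁻ (subst (All (+ i ℤ.≤_)) (sym (map-coabscissa-U i))
  (ℤ.≤-refl ∷ i≤ ∷ i≤ ∷ i≤ ∷ []))
  where i≤ = ℤ.+≤+ (n≤1+n i)

U-coabscissa< : ∀ i → All (λ c → coabscissa c ℤ.< + suc (suc i)) (cells (U i))
U-coabscissa< i = All.map⁻ (subst (All (ℤ._< + suc (suc i))) (sym (map-coabscissa-U i))
  (ℤ.+<+ (m≤n⇒m≤1+n ≤-refl) ∷ <i ∷ <i ∷ <i ∷ []))
  where <i = ℤ.+<+ ≤-refl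

D-coabscissa≥ : ∀ i → All (λ c → + suc i ℤ.≤ coabscissa c) (cells (D i))
D-coabscissa≥ i = All.map⁻ (subst (All (+ suc i ℤ.≤_)) (sym (map-coabscissa-D i))
  (ℤ.+≤+ (n≤1+n _) ∷ ℤ.≤-refl ∷ ℤ.≤-refl ∷ ℤ.≤-refl ∷ []))

D-coabscissa< : ∀ i → All (λ c → coabscissa c ℤ.< + suc (suc (suc i))) (cells (D i))
D-coabscissa< i = All.map⁻ (subst (All (ℤ._< + suc (suc (suc i)))) (sym (map-coabscissa-D i))
  (ℤ.+<+ ≤-refl ∷ <i ∷ <i ∷ <i ∷ []))
  where <i = ℤ.+<+ (m≤n⇒m≤1+n ≤-refl)

-- The coabscissa takes the values `j` and `j + 1` on `U j`, and `j + 1` and `j + 2` on `D j`. So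
-- tiles of the same orientation need an index gap of two, while `D i` clears every `U j` with
-- `j < i`.
U#U : ∀ {i j} → suc j < i → U i # U j
U#U {i} {j} j+1<i = separated coabscissa (+ i) {U i} {U j} (U-coabscissa≥ i)
  (All.map (λ c< → ℤ.<-≤-trans c< (ℤ.+≤+ j+1<i)) (U-coabscissa< j))

D#D : ∀ {i j} → suc j < i → D i # D j
D#D {i} {j} j+1<i = separated coabscissa (+ suc i) {D i} {D j} (D-coabscissa≥ i)
  (All.map (λ c< → ℤ.<-≤-trans c< (ℤ.+≤+ (s≤s j+1<i))) (D-coabscissa< j))

D#U : ∀ {i j} → j < i → D i # U j
D#U {i} {j} j<i = separated coabscissa (+ suc i) {D i} {U j} (D-coabscissa≥ i)
  (All.map (λ c< → ℤ.<-≤-trans c< (ℤ.+≤+ (s≤s j<i))) (U-coabscissa< j))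

-- For `i = j + 1` both tiles have coabscissas `j + 1` and `j + 2`. The abscissa separates them: it
-- is at most `j` on `D j` and at least `i` on `U i`.
U#D : ∀ {i j} → j < i → U i # D j
U#D {i} {j} j<i = separated abscissa (+ i) {U i} {D j} (U-abscissa≥ i)
  (All.map (λ c< → ℤ.<-≤-trans c< (ℤ.+≤+ j<i)) (D-abscissa< j))

¬D#U : ∀ i → ¬ D i # U i
¬D#U i disj = disj {▽ (+ i) 0ℤ}
  (there (there (here refl)) , there (there (there (here refl))))

-- The shared cell is the left corner of `U (suc i)` and the right corner of `U i`, where its
-- abscissa is written `i + 1`.
¬U#U : ∀ i → ¬ U (suc i) # U i
¬U#U i disj = disj (here refl , there (here (cong (λ k → △ (+ k) 0ℤ) (+-comm 1 i))))

¬D#D : ∀ i → ¬ D (suc i) # D i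
¬D#D i disj = disj {▽ (+ i) 1ℤ} (there (here refl) , here refl)

-- V m lists the large tiles in H (suc m), and VD m those in P (suc m); by the
-- symmetry exchanging D and U, VU m has the same counts as VD m.

V VD VU : ℕ → List Tile
V zero     = []
V (suc m)  = D m ∷ U m ∷ V m
VD zero    = []
VD (suc m) = D m ∷ V m
VU zero    = []
VU (suc m) = U m ∷ V m

∈V⁻ : ∀ m {t} → t ∈ V m → ∃[ i ] i < m × (t ≡ D i ⊎ t ≡ U i)
∈V⁻ (suc m) (here refl)         = m , ≤-refl , inj₁ refl
∈V⁻ (suc m) (there (here refl)) = m , ≤-refl , inj₂ refl
∈V⁻ (suc m) (there (there t∈)) with ∈V⁻ m t∈
... | i , i<m , t≡ = i , m≤n⇒m≤1+n i<m , t≡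

∈V⁺ : ∀ {m i} → i < m → D i ∈ V m × U i ∈ V m
∈V⁺ {suc m} {i} i<1+m with m≤n⇒m<n∨m≡n (s≤s⁻¹ i<1+m)
... | inj₂ refl = here refl , there (here refl)
... | inj₁ i<m with ∈V⁺ i<m
...   | D∈ , U∈ = there (there D∈) , there (there U∈)

D∉V : ∀ m → All (D m ≢_) (V m)
D∉V m = All.tabulate λ t∈ → λ { refl → absurd (∈V⁻ m t∈) }
  where
  absurd : ¬ (∃[ i ] i < m × (D m ≡ D i ⊎ D m ≡ U i))
  absurd (_ , m<m , inj₁ refl) = <-irrefl refl m<m

U∉V : ∀ m → All (U m ≢_) (V m)
U∉V m = All.tabulate λ t∈ → λ { refl → absurd (∈V⁻ m t∈) }
  where
  absurd : ¬ (∃[ i ] i < m × (U m ≡ D i ⊎ U m ≡ U i))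
  absurd (_ , m<m , inj₂ refl) = <-irrefl refl m<m

V-unique : ∀ m → Unique (V m)
V-unique zero    = []
V-unique (suc m) = ((λ ()) ∷ D∉V m) ∷ U∉V m ∷ V-unique m

VD-unique : ∀ m → Unique (VD m)
VD-unique zero    = []
VD-unique (suc m) = D∉V m ∷ V-unique m

D#V : ∀ m → All (D (suc m) #_) (V m)
D#V m = All.tabulate λ t∈ → disj (∈V⁻ m t∈)
  where
  disj : ∀ {t} → ∃[ i ] i < m × (t ≡ D i ⊎ t ≡ U i) → D (suc m) # t
  disj (_ , i<m , inj₁ refl) = D#D (s≤s i<m)
  disj (_ , i<m , inj₂ refl) = D#U (m≤n⇒m≤1+n i<m)

U#V : ∀ m → All (U (suc m) #_) (V m)
U#V m = All.tabulate λ t∈ → disj (∈V⁻ m t∈)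
  where
  disj : ∀ {t} → ∃[ i ] i < m × (t ≡ D i ⊎ t ≡ U i) → U (suc m) # t
  disj (_ , i<m , inj₁ refl) = U#D (m≤n⇒m≤1+n i<m)
  disj (_ , i<m , inj₂ refl) = U#U (s≤s i<m)

-- The only tile of `V m` meeting `D m` is the `D` with the previous index, if there is one: next to
-- a letter D stands U or none. `filter-U#V` is the mirror case.
filter-D#V : ∀ m → filter (D m #?_) (V m) ≡ VU m
filter-D#V zero    = refl
filter-D#V (suc m) =
  trans (filter-reject (D (suc m) #?_) {D m} {U m ∷ V m} (¬D#D m))
  (trans (filter-accept (D (suc m) #?_) {U m} {V m} (D#U {suc m} {m} ≤-refl))
         (cong (U m ∷_) (filter-all (D (suc m) #?_) (D#V m))))

filter-D#UV : ∀ m → filter (D m #?_) (U m ∷ V m) ≡ VU m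
filter-D#UV m = trans (filter-reject (D m #?_) {U m} {V m} (¬D#U m)) (filter-D#V m)

filter-U#V : ∀ m → filter (U m #?_) (V m) ≡ VD m
filter-U#V zero    = refl
filter-U#V (suc m) =
  trans (filter-accept (U (suc m) #?_) {D m} {U m ∷ V m} (U#D {suc m} {m} ≤-refl))
    (cong (D m ∷_) (trans (filter-reject (U (suc m) #?_) {U m} {V m} (¬U#U m))
                          (filter-all (U (suc m) #?_) (U#V m))))

-- Recurrences for the counts, and their exact solution for `κ`.

ν-V : ∀ m → ν (V (suc m)) ≡ ν (VU m) + ν (VU (suc m))
-- Deleting `D m` leaves `U m ∷ V m`, which is `VU (suc m)` by definition.
ν-V m = trans (ν-∷ (D m) (U m ∷ V m)) (cong (λ vs → ν vs + ν (U m ∷ V m)) (filter-D#UV m))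

ν-VU : ∀ m → ν (VU (suc m)) ≡ ν (VD m) + ν (V m)
ν-VU m = trans (ν-∷ (U m) (V m)) (cong (λ vs → ν vs + ν (V m)) (filter-U#V m))

ν-VD : ∀ m → ν (VD (suc m)) ≡ ν (VU m) + ν (V m)
ν-VD m = trans (ν-∷ (D m) (V m)) (cong (λ vs → ν vs + ν (V m)) (filter-D#V m))

κ-V : ∀ m → κ (V (suc m)) ≡ (ν (VU m) + κ (VU m)) + κ (VU (suc m))
κ-V m = trans (κ-∷ (D m) (U m ∷ V m))
  (cong (λ vs → (ν vs + κ vs) + κ (U m ∷ V m)) (filter-D#UV m))

κ-VU : ∀ m → κ (VU (suc m)) ≡ (ν (VD m) + κ (VD m)) + κ (V m)
κ-VU m = trans (κ-∷ (U m) (V m)) (cong (λ vs → (ν vs + κ vs) + κ (V m)) (filter-U#V m))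

κ-VD : ∀ m → κ (VD (suc m)) ≡ (ν (VU m) + κ (VU m)) + κ (V m)
κ-VD m = trans (κ-∷ (D m) (V m)) (cong (λ vs → (ν vs + κ vs) + κ (V m)) (filter-D#V m))

-- The symmetry enters through the recurrences: `ν-VU` and `ν-VD` differ only by exchanging `VD m`
-- and `VU m` on the right, so induction applies.
ν-VU≡VD : ∀ m → ν (VU m) ≡ ν (VD m)
ν-VU≡VD zero    = refl
ν-VU≡VD (suc m) = trans (ν-VU m)
  (trans (cong (_+ ν (V m)) (sym (ν-VU≡VD m))) (sym (ν-VD m)))

κ-VU≡VD : ∀ m → κ (VU m) ≡ κ (VD m)
κ-VU≡VD zero    = refl
κ-VU≡VD (suc m) = trans (κ-VU m)
  (trans (cong (_+ κ (V m)) (sym (cong₂ _+_ (ν-VU≡VD m) (κ-VU≡VD m)))) (sym (κ-VD m)))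

ν-VD≤ν-V : ∀ m → ν (VD m) ≤ ν (V m)
ν-VD≤ν-V zero    = ≤-refl
ν-VD≤ν-V (suc m) = subst₂ _≤_ (ν-VU≡VD (suc m)) (sym (ν-V m)) (m≤n+m _ _)

-- By the second identity an independent subset of `VD m` has `m / 2` elements on average. The
-- recurrences for `V` and `VD` are coupled, hence one induction for both.
2κ : ∀ m → (2 * κ (V m) + ν (VD m) ≡ suc m * ν (V m)) × (2 * κ (VD m) ≡ m * ν (VD m))
2κ zero    = refl , refl
2κ (suc m) with 2κ m
... | κ-a , κ-b = step-V , step-VD
  where
  open ≡-Reasoning
  a = ν (V m)
  b = ν (VD m)
  a′ = ν (V (suc m))
  b′ = ν (VD (suc m))

  b′≡ : b′ ≡ b + a
  b′≡ = trans (ν-VD m) (cong (_+ a) (ν-VU≡VD m))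

  a′≡ : a′ ≡ b + b′
  a′≡ = trans (ν-V m) (cong₂ _+_ (ν-VU≡VD m) (ν-VU≡VD (suc m)))

  step-VD : 2 * κ (VD (suc m)) ≡ suc m * b′
  step-VD = begin
    2 * κ (VD (suc m))
      ≡⟨ cong (2 *_) (κ-VD m) ⟩
    2 * ((ν (VU m) + κ (VU m)) + κ (V m))
      ≡⟨ cong₂ (λ x y → 2 * ((x + y) + κ (V m))) (ν-VU≡VD m) (κ-VU≡VD m) ⟩
    2 * ((b + κ (VD m)) + κ (V m))
      -- Of the `2 * b` contributed by `D m`, one `b` completes the hypothesis `κ-a`; the other
      -- turns `m * b` into `suc m * b`.
      ≡⟨ expand b (κ (VD m)) (κ (V m)) ⟩
    b + (2 * κ (VD m) + (2 * κ (V m) + b))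
      ≡⟨ cong₂ (λ x y → b + (x + y)) κ-b κ-a ⟩
    b + (m * b + suc m * a)
      ≡⟨ collect m a b ⟩
    suc m * (b + a)
      ≡⟨ cong (suc m *_) b′≡ ⟨
    suc m * b′ ∎
    where
    expand : ∀ b x y → 2 * ((b + x) + y) ≡ b + (2 * x + (2 * y + b))
    expand = solve-∀
    collect : ∀ m a b → b + (m * b + (1 + m) * a) ≡ (1 + m) * (b + a)
    collect = solve-∀

  step-V : 2 * κ (V (suc m)) + b′ ≡ suc (suc m) * a′
  step-V = begin
    2 * κ (V (suc m)) + b′
      ≡⟨ cong (λ x → 2 * x + b′) (κ-V m) ⟩
    2 * ((ν (VU m) + κ (VU m)) + κ (VU (suc m))) + b′
      ≡⟨ cong₂ (λ x y → 2 * (x + y) + b′)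
           (cong₂ _+_ (ν-VU≡VD m) (κ-VU≡VD m)) (κ-VU≡VD (suc m)) ⟩
    2 * ((b + κ (VD m)) + κ (VD (suc m))) + b′
      ≡⟨ expand b b′ (κ (VD m)) (κ (VD (suc m))) ⟩
    2 * b + (2 * κ (VD m) + (2 * κ (VD (suc m)) + b′))
      -- The identity for `VD (suc m)` enters here; the additional `2 * b` and `b′` raise both
      -- coefficients to `m + 2`.
      ≡⟨ cong₂ (λ x y → 2 * b + (x + (y + b′))) κ-b step-VD ⟩
    2 * b + (m * b + (suc m * b′ + b′))
      ≡⟨ collect m b b′ ⟩
    suc (suc m) * (b + b′)
      ≡⟨ cong (suc (suc m) *_) a′≡ ⟨
    suc (suc m) * a′ ∎
    where
    expand : ∀ b b′ x y → 2 * ((b + x) + y) + b′ ≡ 2 * b + (2 * x + (2 * y + b′))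
    expand = solve-∀
    collect : ∀ m b b′ → 2 * b + (m * b + ((1 + m) * b′ + b′)) ≡ (2 + m) * (b + b′)
    collect = solve-∀

-- The cells of the strips, and which large tiles fit inside.

data ∈H (m : ℕ) : Cell → Set where
  △₀ : ∀ {i} → i ≤ m → ∈H m (△ (+ i) 0ℤ)
  ▽₀ : ∀ {i} → i < m → ∈H m (▽ (+ i) 0ℤ)
  -- The abscissa is a variable with an equation because `+ i ℤ.- 1ℤ` is not an index that matching
  -- could invert.
  ▽₁ : ∀ {i a} → i ≤ m → a ≡ + i ℤ.- 1ℤ → ∈H m (▽ a 1ℤ)
  △₁ : ∀ {i} → i < m → ∈H m (△ (+ i) 1ℤ)

∈-map-upTo⁻ : {A : Set} (f : ℕ → A) → ∀ {n x} → x ∈ map f (upTo n) → ∃[ i ] i < n × x ≡ f i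
∈-map-upTo⁻ f x∈ with ∈-map⁻ f x∈
... | i , i∈ , x≡ = i , ∈-upTo⁻ i∈ , x≡

∈H⁻ : ∀ m {c} → c ∈ H (suc m) → ∈H m c
∈H⁻ m c∈ with ∈-++⁻ (lower (suc m)) c∈
∈H⁻ m c∈ | inj₁ c∈l with ∈-++⁻ (map (λ i → △ (+ i) 0ℤ) (upTo (suc m))) c∈l
... | inj₁ c∈′ with ∈-map-upTo⁻ _ c∈′
...   | _ , i< , refl = △₀ (s≤s⁻¹ i<)
∈H⁻ m c∈ | inj₁ c∈l | inj₂ c∈′ with ∈-map-upTo⁻ _ c∈′
...   | _ , i< , refl = ▽₀ i<
∈H⁻ m c∈ | inj₂ c∈u with ∈-++⁻ (map (λ i → ▽ (+ i ℤ.- 1ℤ) 1ℤ) (upTo (suc m))) c∈u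
... | inj₁ c∈′ with ∈-map-upTo⁻ _ c∈′
...   | _ , i< , refl = ▽₁ (s≤s⁻¹ i<) refl
∈H⁻ m c∈ | inj₂ c∈u | inj₂ c∈′ with ∈-map-upTo⁻ _ c∈′
...   | _ , i< , refl = △₁ i<

∈H⁺ : ∀ m {c} → ∈H m c → c ∈ H (suc m)
∈H⁺ m (△₀ i≤)      = ∈-++⁺ˡ (∈-++⁺ˡ (∈-map⁺ _ (∈-upTo⁺ (s≤s i≤))))
∈H⁺ m (▽₀ i<)      =
  ∈-++⁺ˡ (∈-++⁺ʳ (map (λ i → △ (+ i) 0ℤ) (upTo (suc m))) (∈-map⁺ _ (∈-upTo⁺ i<)))
∈H⁺ m (▽₁ i≤ refl) = ∈-++⁺ʳ (lower (suc m)) (∈-++⁺ˡ (∈-map⁺ _ (∈-upTo⁺ (s≤s i≤))))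
∈H⁺ m (△₁ i<)      =
  ∈-++⁺ʳ (lower (suc m)) (∈-++⁺ʳ (map (λ i → ▽ (+ i ℤ.- 1ℤ) 1ℤ) (upTo (suc m)))
    (∈-map⁺ _ (∈-upTo⁺ i<)))

U-inside : ∀ m {i} → i < m → Inside (H (suc m)) (U i)
U-inside m {i} i<m =
  ∈H⁺ m (△₀ (<⇒≤ i<m)) ∷ ∈H⁺ m (△₀ (subst (_≤ m) (+-comm 1 i) i<m)) ∷
  ∈H⁺ m (△₁ i<m) ∷ ∈H⁺ m (▽₀ i<m) ∷ []

D-inside : ∀ m {i} → i < m → Inside (H (suc m)) (D i)
D-inside m {i} i<m =
  ∈H⁺ m (▽₁ i<m refl) ∷ ∈H⁺ m (▽₁ (<⇒≤ i<m) refl) ∷ ∈H⁺ m (▽₀ i<m) ∷ ∈H⁺ m (△₁ i<m) ∷ []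

V⇒inside : ∀ m {t} → t ∈ V m → IsLarge t × Inside (H (suc m)) t
V⇒inside m t∈ with ∈V⁻ m t∈
... | _ , i<m , inj₁ refl = large _ , D-inside m i<m
... | _ , i<m , inj₂ refl = large _ , U-inside m i<m

-- A large tile spans two rows, so it must fill both. An upward tile based in row 1 would need a
-- cell in row 2, a downward one named in row 0 a cell in row -1. The bound on `i` comes from the
-- cell `△` in row 1, which both orientations contain.
inside-H : ∀ m {t} → IsLarge t → Inside (H (suc m)) t → ∃[ i ] i < m × (t ≡ D i ⊎ t ≡ U i)
inside-H m (large (△ a b)) (c₁ ∷ _ ∷ c₂ ∷ _) with ∈H⁻ m c₁
... | △₀ _ with ∈H⁻ m c₂
...   | △₁ i<m = _ , i<m , inj₂ refl
inside-H m (large (△ a b)) (c₁ ∷ _ ∷ c₂ ∷ _) | △₁ _ with ∈H⁻ m c₂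
...   | ()
inside-H m (large (▽ a b)) (_ ∷ _ ∷ c₁ ∷ c₂ ∷ _) with ∈H⁻ m c₂
... | △₁ i<m = _ , i<m , inj₁ refl
... | △₀ _ with ∈H⁻ m c₁
...   | ()

inside⇒V : ∀ m {t} → IsLarge t → Inside (H (suc m)) t → t ∈ V m
inside⇒V m l ins with inside-H m l ins
... | _ , i<m , inj₁ refl = proj₁ (∈V⁺ i<m)
... | _ , i<m , inj₂ refl = proj₂ (∈V⁺ i<m)

corner? : ∀ m → Decidable (_≢ △ (+ m) 0ℤ)
corner? m c = ¬? (c ≟ △ (+ m) 0ℤ)

P⊆H : ∀ m {c} → c ∈ P (suc m) → c ∈ H (suc m) × c ≢ △ (+ m) 0ℤ
P⊆H m = ∈-filter⁻ (corner? m) {xs = H (suc m)}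

∈P : ∀ m {c} → c ∈ H (suc m) → c ≢ △ (+ m) 0ℤ → c ∈ P (suc m)
∈P m = ∈-filter⁺ (corner? m)

-- The right corner of `U i` is the removed cell exactly when `suc i ≡ m`.
U-inside-P : ∀ m {i} → suc i < m → Inside (P (suc m)) (U i)
U-inside-P m {i} i+1<m with U-inside m (<⇒≤ i+1<m)
... | c₁ ∷ c₂ ∷ c₃ ∷ c₄ ∷ [] =
    ∈P m c₁ (λ eq → <⇒≢ (<⇒≤ i+1<m) (ℤ.+-injective (cong abscissa eq)))
  ∷ ∈P m c₂ (λ eq → <⇒≢ i+1<m (trans (+-comm 1 i) (ℤ.+-injective (cong abscissa eq))))
  ∷ ∈P m c₃ (λ ()) ∷ ∈P m c₄ (λ ()) ∷ []

D-inside-P : ∀ m {i} → i < m → Inside (P (suc m)) (D i)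
D-inside-P m {i} i<m with D-inside m i<m
... | c₁ ∷ c₂ ∷ c₃ ∷ c₄ ∷ [] =
  ∈P m c₁ (λ ()) ∷ ∈P m c₂ (λ ()) ∷ ∈P m c₃ (λ ()) ∷ ∈P m c₄ (λ ()) ∷ []

VD⇒inside : ∀ m {t} → t ∈ VD m → IsLarge t × Inside (P (suc m)) t
VD⇒inside (suc m) (here refl) = large _ , D-inside-P (suc m) ≤-refl
VD⇒inside (suc m) (there t∈) with ∈V⁻ m t∈
... | _ , i<m , inj₁ refl = large _ , D-inside-P (suc m) (m≤n⇒m≤1+n i<m)
... | _ , i<m , inj₂ refl = large _ , U-inside-P (suc m) (s≤s i<m)

inside⇒VD : ∀ m {t} → IsLarge t → Inside (P (suc m)) t → t ∈ VD m
inside⇒VD m l ins with inside-H m l (All.map (proj₁ ∘ P⊆H m) ins)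
... | _ , i<m , t≡ = member m i<m t≡ ins
  where
  member : ∀ m {i t} → i < m → t ≡ D i ⊎ t ≡ U i → Inside (P (suc m)) t → t ∈ VD m
  member (suc m) {i} i<1+m t≡ ins with m≤n⇒m<n∨m≡n (s≤s⁻¹ i<1+m) | t≡ | ins
  ... | inj₁ i<m  | inj₁ refl | _         = there (proj₁ (∈V⁺ i<m))
  ... | inj₁ i<m  | inj₂ refl | _         = there (proj₂ (∈V⁺ i<m))
  ... | inj₂ refl | inj₁ refl | _         = here refl
  -- The last `U` is excluded: its second cell is the removed one.
  ... | inj₂ refl | inj₂ refl | _ ∷ c ∷ _ =
    contradiction (cong (λ k → △ (+ k) 0ℤ) (+-comm i 1)) (proj₂ (P⊆H (suc m) c))

length-trapezoid : {A : Set} (f g : ℕ → A) → ∀ k l →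
  length (map f (upTo k) ++ map g (upTo l)) ≡ k + l
length-trapezoid f g k l = trans (length-++ (map f (upTo k)))
  (cong₂ _+_ (trans (length-map f (upTo k)) (length-upTo k))
             (trans (length-map g (upTo l)) (length-upTo l)))

length-H : ∀ m → length (H (suc m)) ≡ 4 * m + 2
length-H m = trans (length-++ (lower (suc m)))
  (trans (cong₂ _+_ (length-trapezoid _ _ (suc m) m) (length-trapezoid _ _ (suc m) m)) (lemma m))
  where
  lemma : ∀ m → ((1 + m) + m) + ((1 + m) + m) ≡ 4 * m + 2
  lemma = solve-∀

-- Putting the removed corner back in front of `P (suc m)` gives a permutation of `H (suc m)`.
length-P : ∀ m → length (P (suc m)) ≡ 4 * m + 1
length-P m = suc-injective (trans (↭.↭-length
  (unique∧set⇒↭ (corner∉P ∷ P-unique (suc m)) (H-unique (suc m)) to from))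
  (trans (length-H m) (+-suc (4 * m) 1)))
  where
  corner∉P : All (△ (+ m) 0ℤ ≢_) (P (suc m))
  corner∉P = All.tabulate (λ c∈ eq → proj₂ (P⊆H m c∈) (sym eq))
  to : ∀ {c} → c ∈ △ (+ m) 0ℤ ∷ P (suc m) → c ∈ H (suc m)
  to (here refl) = ∈H⁺ m (△₀ ≤-refl)
  to (there c∈)  = proj₁ (P⊆H m c∈)
  from : ∀ {c} → c ∈ H (suc m) → c ∈ △ (+ m) 0ℤ ∷ P (suc m)
  from {c} c∈ with c ≟ △ (+ m) 0ℤ
  ... | yes refl = here refl
  ... | no  c≢   = there (∈P m c∈ c≢)

-- From a bounded deviation to a limit.

∣-∣≤ : ∀ {k l c} → k ≤ l + c → l ≤ k + c → ℤ.∣ + k ℤ.- + l ∣ ≤ c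
∣-∣≤ {k} {l} {c} k≤ l≤ rewrite ℤ.m-n≡m⊖n k l with ≤-total k l
... | inj₁ k≤l rewrite ℤ.∣⊖∣-≤ k≤l = m≤n+o⇒m∸n≤o l k l≤
... | inj₂ l≤k rewrite ℤ.∣m⊖n∣≡∣n⊖m∣ k l | ℤ.∣⊖∣-≤ l≤k = m≤n+o⇒m∸n≤o k l k≤

-- Here x / d − c / 5 has numerator 5x − cd, so it is at most C / 5d ≤ 4 / 5n
-- in absolute value.

ratio-close : ∀ x d c C n .{{_ : NonZero d}} ε → 0ℚ ℚ.< ε → ↧ₙ ε ≤ n →
  x * 5 ≤ c * d + C → c * d ≤ x * 5 + C → n * C ≤ 4 * d →
  ℚ.∣ (+ x / d) ℚ.- (+ c / 5) ∣ ℚ.< ε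
ratio-close x (suc d) c C n ε 0<ε ε≤n x≤ c≤ nC≤ with ℚ.positive 0<ε
-- Positivity leaves only `ε` of the form `(k + 1) / (e + 1)`, and `ε≤n` becomes `suc e ≤ n`; hence
-- `1 / n` is at most `ε`.
ratio-close x (suc d) c C n ε@(mkℚ (+[1+ k ]) e _) 0<ε ε≤n x≤ c≤ nC≤ | _ =
  ℚ.toℚᵘ-cancel-< (ℚᵘ.<-respˡ-≃ (ℚᵘ.≃-sym distance) (*<*
    (subst (ℤ._< _) (ℤ.pos-* ℤ.∣ num ∣ (suc e)) (ℤ.+<+ bound))))
  where
  num : ℤ
  num = + x ℤ.* + 5 ℤ.+ (ℤ.- (+ c)) ℤ.* + suc d

  x/d = mkℚᵘ (+ x) d
  c/5 = mkℚᵘ (+ c) 4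

  -- Unnormalised rationals keep the numerator `num` and the denominator `suc d * 5` explicit, with
  -- no common factor cancelled.
  distance : ℚ.toℚᵘ ℚ.∣ (+ x / suc d) ℚ.- (+ c / 5) ∣ ℚᵘ.≃ ℚᵘ.∣ x/d ℚᵘ.- c/5 ∣
  distance = begin
    ℚ.toℚᵘ ℚ.∣ ℚ.fromℚᵘ x/d ℚ.- ℚ.fromℚᵘ c/5 ∣
      ≈⟨ ℚ.toℚᵘ-homo-∣-∣ _ ⟩
    ℚᵘ.∣ ℚ.toℚᵘ (ℚ.fromℚᵘ x/d ℚ.- ℚ.fromℚᵘ c/5) ∣
      ≈⟨ ℚᵘ.∣-∣-cong (ℚ.toℚᵘ-homo-+ (ℚ.fromℚᵘ x/d) (ℚ.- ℚ.fromℚᵘ c/5)) ⟩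
    ℚᵘ.∣ ℚ.toℚᵘ (ℚ.fromℚᵘ x/d) ℚᵘ.+ ℚ.toℚᵘ (ℚ.- ℚ.fromℚᵘ c/5) ∣
      ≈⟨ ℚᵘ.∣-∣-cong (ℚᵘ.+-cong (ℚ.toℚᵘ-fromℚᵘ x/d)
           (ℚᵘ.≃-trans (ℚ.toℚᵘ-homo‿- (ℚ.fromℚᵘ c/5)) (ℚᵘ.-‿cong (ℚ.toℚᵘ-fromℚᵘ c/5)))) ⟩
    ℚᵘ.∣ x/d ℚᵘ.- c/5 ∣ ∎
    where open import Relation.Binary.Reasoning.Setoid ℚᵘ.≃-setoid

  num≤ : ℤ.∣ num ∣ ≤ C
  num≤ = subst (λ i → ℤ.∣ i ∣ ≤ C)
    (cong₂ ℤ._+_ (ℤ.pos-* x 5)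
      (trans (cong ℤ.-_ (ℤ.pos-* c (suc d))) (ℤ.neg-distribˡ-* (+ c) (+ suc d))))
    (∣-∣≤ x≤ c≤)

  bound : ℤ.∣ num ∣ * suc e < suc k * (suc d * 5)
  bound = begin-strict
    ℤ.∣ num ∣ * suc e      ≤⟨ *-mono-≤ num≤ ε≤n ⟩
    C * n                  ≡⟨ *-comm C n ⟩
    n * C                  ≤⟨ nC≤ ⟩
    -- Strictness comes from here: the 4 of the hypothesis against the 5 of the denominator.
    4 * suc d              <⟨ *-monoˡ-< (suc d) (≤-refl {5}) ⟩
    5 * suc d              ≡⟨ *-comm 5 (suc d) ⟩
    suc d * 5              ≤⟨ m≤n*m (suc d * 5) (suc k) ⟩
    suc k * (suc d * 5)    ∎
    where open ≤-Reasoning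

-- Since 5s - 4(s + l) = s - 4l and 5l - (s + l) = 4l - s, a bound `c` on the deviation of `s` from
-- `4 * l` controls both ratios. The factor `1 *` matches the form required by `ratio-close`.
module _ (s l : ℕ) {c : ℕ} where

  open ≤-Reasoning

  5s≤ : s ≤ 4 * l + c → s * 5 ≤ 4 * (s + l) + c
  5s≤ s≤ = begin
    s * 5                ≡⟨ *-suc s 4 ⟩
    s + s * 4            ≤⟨ +-monoˡ-≤ (s * 4) s≤ ⟩
    4 * l + c + s * 4    ≡⟨ regroup s l c ⟩
    4 * (s + l) + c      ∎
    where
    regroup : ∀ s l c → 4 * l + c + s * 4 ≡ 4 * (s + l) + c
    regroup = solve-∀

  ≤5s : 4 * l ≤ s + c → 4 * (s + l) ≤ s * 5 + c
  ≤5s l≤ = begin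
    4 * (s + l)          ≡⟨ *-distribˡ-+ 4 s l ⟩
    4 * s + 4 * l        ≤⟨ +-monoʳ-≤ (4 * s) l≤ ⟩
    4 * s + (s + c)      ≡⟨ regroup s c ⟩
    s * 5 + c            ∎
    where
    regroup : ∀ s c → 4 * s + (s + c) ≡ s * 5 + c
    regroup = solve-∀

  5l≤ : 4 * l ≤ s + c → l * 5 ≤ 1 * (s + l) + c
  5l≤ l≤ = begin
    l * 5                ≡⟨ *-comm l 5 ⟩
    l + 4 * l            ≤⟨ +-monoʳ-≤ l l≤ ⟩
    l + (s + c)          ≡⟨ regroup s l c ⟩
    1 * (s + l) + c      ∎
    where
    regroup : ∀ s l c → l + (s + c) ≡ 1 * (s + l) + c
    regroup = solve-∀

  ≤5l : s ≤ 4 * l + c → 1 * (s + l) ≤ l * 5 + c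
  ≤5l s≤ = begin
    1 * (s + l)          ≡⟨ *-identityˡ (s + l) ⟩
    s + l                ≤⟨ +-monoˡ-≤ l s≤ ⟩
    4 * l + c + l        ≡⟨ regroup l c ⟩
    l * 5 + c            ∎
    where
    regroup : ∀ l c → 4 * l + c + l ≡ l * 5 + c
    regroup = solve-∀

-- Common to both strips: `S` and `L` total the small and large tiles, and `C m` bounds the
-- deviation of `S` from `4 * L`, relative to `T` of order `1 / n`.
module Limits
  (S L T C : ℕ → ℕ) (T≢0 : ∀ n → .{{NonZero n}} → NonZero (T n))
  (T≡S+L : ∀ n → T n ≡ S n + L n)
  (S≤4L+C : ∀ m → S (suc m) ≤ 4 * L (suc m) + C m)
  (4L≤S+C : ∀ m → 4 * L (suc m) ≤ S (suc m) + C m)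
  (nC≤4T : ∀ m → suc m * C m ≤ 4 * T (suc m)) where

  S/T→4/5 : Tendsto (λ n → (+ S n / T n) {{T≢0 n}}) (+ 4 / 5)
  S/T→4/5 ε 0<ε = ↧ₙ ε , λ where
      (suc m) ε≤n → ratio-close (S (suc m)) (T (suc m)) 4 (C m) (suc m) {{T≢0 (suc m)}} ε 0<ε ε≤n
        (subst (λ t → S (suc m) * 5 ≤ 4 * t + C m) (sym (T≡S+L (suc m)))
          (5s≤ (S (suc m)) (L (suc m)) (S≤4L+C m)))
        (subst (λ t → 4 * t ≤ S (suc m) * 5 + C m) (sym (T≡S+L (suc m)))
          (≤5s (S (suc m)) (L (suc m)) (4L≤S+C m)))
        (nC≤4T m)

  L/T→1/5 : Tendsto (λ n → (+ L n / T n) {{T≢0 n}}) (+ 1 / 5)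
  L/T→1/5 ε 0<ε = ↧ₙ ε , λ where
      (suc m) ε≤n → ratio-close (L (suc m)) (T (suc m)) 1 (C m) (suc m) {{T≢0 (suc m)}} ε 0<ε ε≤n
        (subst (λ t → L (suc m) * 5 ≤ 1 * t + C m) (sym (T≡S+L (suc m)))
          (5l≤ (S (suc m)) (L (suc m)) (4L≤S+C m)))
        (subst (λ t → 1 * t ≤ L (suc m) * 5 + C m) (sym (T≡S+L (suc m)))
          (≤5l (S (suc m)) (L (suc m)) (S≤4L+C m)))
        (nC≤4T m)

-- The deviations and their bounds for `H` and `P`.

module _ (m : ℕ) where

  private
    n = suc m
    a = ν (V m)
    b = ν (VD m)

  φ+4q : φ n + 4 * q n ≡ a * (4 * m + 2)
  φ+4q = trans (#small+4#large (H-unique n))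
    (cong₂ _*_ (length-tilings (H-unique n) (V-unique m) (V⇒inside m) (inside⇒V m)) (length-H m))

  θ+4r : θ n + 4 * r n ≡ b * (4 * m + 1)
  θ+4r = trans (#small+4#large (P-unique n))
    (cong₂ _*_ (length-tilings (P-unique n) (VD-unique m) (VD⇒inside m) (inside⇒VD m)) (length-P m))

  2q+b : 2 * q n + b ≡ suc m * a
  2q+b = trans (cong (λ k → 2 * k + b)
    (#large≡κ (H-unique n) (V-unique m) (V⇒inside m) (inside⇒V m))) (proj₁ (2κ m))

  2r : 2 * r n ≡ m * b
  2r = trans (cong (2 *_)
    (#large≡κ (P-unique n) (VD-unique m) (VD⇒inside m) (inside⇒VD m))) (proj₂ (2κ m))

  φ+2a : φ n + 2 * a ≡ 4 * q n + 4 * b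
  -- Adding `2 * a` turns the area total `a * (4 * m + 2)` into four times the right side of `2q+b`;
  -- the spare `4 * q n` is then cancelled.
  φ+2a = +-cancelʳ-≡ (4 * q n) _ _ (begin
    φ n + 2 * a + 4 * q n              ≡⟨ regroup (φ n) (2 * a) (4 * q n) ⟩
    (φ n + 4 * q n) + 2 * a            ≡⟨ cong (_+ 2 * a) φ+4q ⟩
    a * (4 * m + 2) + 2 * a            ≡⟨ scale m a ⟩
    4 * (suc m * a)                    ≡⟨ cong (4 *_) 2q+b ⟨
    4 * (2 * q n + b)                  ≡⟨ expand (q n) b ⟩
    4 * q n + 4 * b + 4 * q n          ∎)
    where
    open ≡-Reasoning
    regroup : ∀ x y z → x + y + z ≡ (x + z) + y
    regroup = solve-∀
    scale : ∀ m a → a * (4 * m + 2) + 2 * a ≡ 4 * ((1 + m) * a)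
    scale = solve-∀
    expand : ∀ q b → 4 * (2 * q + b) ≡ 4 * q + 4 * b + 4 * q
    expand = solve-∀

  -- By `2r`, 8r = 4mb, so the area total θ + 4r = (4m + 1)b exceeds 8r by exactly `b`.
  θ≡4r+b : θ n ≡ 4 * r n + b
  θ≡4r+b = +-cancelʳ-≡ (4 * r n) _ _ (begin
    θ n + 4 * r n                      ≡⟨ θ+4r ⟩
    b * (4 * m + 1)                    ≡⟨ scale m b ⟩
    4 * (m * b) + b                    ≡⟨ cong (λ k → 4 * k + b) 2r ⟨
    4 * (2 * r n) + b                  ≡⟨ expand (r n) b ⟩
    4 * r n + b + 4 * r n              ∎)
    where
    open ≡-Reasoning
    scale : ∀ m b → b * (4 * m + 1) ≡ 4 * (m * b) + b
    scale = solve-∀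
    expand : ∀ r b → 4 * (2 * r) + b ≡ 4 * r + b + 4 * r
    expand = solve-∀

  -- By `φ+2a` the deviation φ - 4q is 4b - 2a. It lies between -2a and 2a because b is between 0
  -- and a; this bound and the next are the two halves.
  4q≤φ+2a : 4 * q n ≤ φ n + 2 * a
  4q≤φ+2a = ≤-trans (m≤m+n _ _) (≤-reflexive (sym φ+2a))

  φ≤4q+2a : φ n ≤ 4 * q n + 2 * a
  φ≤4q+2a = +-cancelʳ-≤ (2 * a) _ _ (begin
    φ n + 2 * a                        ≡⟨ φ+2a ⟩
    4 * q n + 4 * b                    ≤⟨ +-monoʳ-≤ (4 * q n) (*-monoʳ-≤ 4 (ν-VD≤ν-V m)) ⟩
    4 * q n + 4 * a                    ≡⟨ split (4 * q n) a ⟩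
    4 * q n + 2 * a + 2 * a            ∎)
    where
    open ≤-Reasoning
    split : ∀ x a → x + 4 * a ≡ x + 2 * a + 2 * a
    split = solve-∀

  -- A tile covers at most four cells, so `4 * h n` is at least the total area of the `a` tilings,
  -- each of area 4m + 2 = 2n + 2m.
  n2a≤4h : n * (2 * a) ≤ 4 * h n
  n2a≤4h = begin
    n * (2 * a)                        ≤⟨ m≤m+n _ (a * (2 * m)) ⟩
    n * (2 * a) + a * (2 * m)          ≡⟨ collect m a ⟩
    a * (4 * m + 2)                    ≡⟨ φ+4q ⟨
    φ n + 4 * q n                      ≤⟨ +-monoˡ-≤ (4 * q n) (m≤n*m (φ n) 4) ⟩
    4 * φ n + 4 * q n                  ≡⟨ *-distribˡ-+ 4 (φ n) (q n) ⟨
    4 * (φ n + q n)                    ≡⟨ cong (4 *_) (#tiles≡#small+#large (H n)) ⟨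
    4 * h n                            ∎
    where
    open ≤-Reasoning
    collect : ∀ m a → (1 + m) * (2 * a) + a * (2 * m) ≡ a * (4 * m + 2)
    collect = solve-∀

  -- The same count with area 4m + 1 = n + 3m.
  nb≤4p : n * b ≤ 4 * p n
  nb≤4p = begin
    n * b                              ≤⟨ m≤m+n _ (b * (3 * m)) ⟩
    n * b + b * (3 * m)                ≡⟨ collect m b ⟩
    b * (4 * m + 1)                    ≡⟨ θ+4r ⟨
    θ n + 4 * r n                      ≤⟨ +-monoˡ-≤ (4 * r n) (m≤n*m (θ n) 4) ⟩
    4 * θ n + 4 * r n                  ≡⟨ *-distribˡ-+ 4 (θ n) (r n) ⟨
    4 * (θ n + r n)                    ≡⟨ cong (4 *_) (#tiles≡#small+#large (P n)) ⟨
    4 * p n                            ∎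
    where
    open ≤-Reasoning
    collect : ∀ m b → (1 + m) * b + b * (3 * m) ≡ b * (4 * m + 1)
    collect = solve-∀

module H-limits = Limits φ q h (λ m → 2 * ν (V m)) h-nonZero
  (#tiles≡#small+#large ∘ H) φ≤4q+2a 4q≤φ+2a n2a≤4h

module P-limits = Limits θ r p (ν ∘ VD) p-nonZero
  (#tiles≡#small+#large ∘ P)
  (≤-reflexive ∘ θ≡4r+b)
  (λ m → ≤-trans (m≤m+n _ _) (≤-trans (≤-reflexive (sym (θ≡4r+b m))) (m≤m+n _ _)))
  nb≤4p

theorem7 : Tendsto (λ n → (+ φ n / h n) {{h-nonZero n}}) (+ 4 / 5)
    × Tendsto (λ n → (+ θ n / p n) {{p-nonZero n}}) (+ 4 / 5)
    × Tendsto (λ n → (+ q n / h n) {{h-nonZero n}}) (+ 1 / 5)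
    × Tendsto (λ n → (+ r n / p n) {{p-nonZero n}}) (+ 1 / 5)
theorem7 = H-limits.S/T→4/5 , P-limits.S/T→4/5 , H-limits.L/T→1/5 , P-limits.L/T→1/5
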